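{- Let $n>3$ be a positive integer. Then the complete bipartite graph $K_{n,n}$ is a weak ordered super TAT graph; that is, $K_{n,n}$ admits a total labeling that is simultaneously super, totally antimagic total, and weak ordered.
   Context: All graphs are finite, undirected and simple. $K_{n,n}$ is the complete bipartite graph with $n$ vertices in each partite set. Let $G$ be a graph with $p=|V(G)|$ vertices and $q=|E(G)|$ edges. A total labeling of $G$ is a bijection $f:V(G)\cup E(G)\to\{1,2,\dots,p+q\}$. It is super if $f(V(G))=\{1,2,\dots,p\}$. The edge-weight of $uv\in E(G)$ is $wt_f(uv)=f(u)+f(uv)+f(v)$, and the vertex-weight of $v\in V(G)$ is $wt_f(v)=f(v)+\sum_{u\in N(v)}f(uv)$, where $N(v)$ is the set of neighbors of $v$. The labeling $f$ is edge-antimagic total (EAT) if all edge-weights are pairwise distinct, and vertex-antimagic total (VAT) if all vertex-weights are pairwise distinct. It is totally antimagic total (TAT) if it is both EAT and VAT. A labeling $f$ is ordered on a set $S$ of vertices if $wt_f(u)\le wt_f(v)$ for every pair $u,v\in S$ with $f(u)<f(v)$. A labeling $f$ of $G$ is weak ordered if, for some positive integer $k$, the vertex set $V(G)$ can be partitioned into $k$ sets on each of which $f$ is ordered. A graph is a weak ordered super TAT graph if it admits a total labeling that is weak ordered, super and TAT. -}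

module Defs where

open import Data.Nat.Base using (ℕ; suc; _+_; _≤_; _<_)
open import Data.Fin using (Fin; toℕ; splitAt) renaming (_<_ to _<ᶠ_)
open import Data.Fin.Properties using (<-cmp) renaming (_<?_ to _<ᶠ?_)
open import Data.Fin.Subset using (Subset; _∈_; Nonempty)
open import Data.List.Base
  using (length; map; filter; allFin; cartesianProduct)
open import Data.Nat.ListAction using (sum)
open import Data.Product using (∃; ∃!; _×_; _,_)
open import Data.Sum.Base using (_⊎_; inj₁; inj₂)
open import Data.Unit.Base using (⊤; tt)
open import Data.Empty using (⊥; ⊥-elim)
open import Function.Base using (_on_)
open import Function.Bundles using (_⤖_; _⇔_; module Bijection)
open import Function.Definitions using (Injective)
open import Level using (0ℓ)
open import Relation.Binary.Core using (Rel)
open import Relation.Binary.Definitions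
  using (Decidable; Symmetric; Irreflexive; tri<; tri≈; tri>)
open import Relation.Binary.PropositionalEquality using (_≡_; refl)
open import Relation.Nullary.Decidable using (Dec; yes; no; _×-dec_)

record Graph : Set₁ where
  field
    order  : ℕ
    Adj    : Rel (Fin order) 0ℓ
    adj?   : Decidable Adj
    symm   : Symmetric Adj
    irrefl : Irreflexive _≡_ Adj

  Vertex : Set
  Vertex = Fin order

  -- An undirected edge is represented once, by its endpoints in increasing
  -- index order.  The proofs are irrelevant, so that edges with the same
  -- endpoints are equal even when Adj has several proofs.
  record Edge : Set where
    constructor edge
    field
      end₁ end₂ : Vertex
      .ordered  : end₁ <ᶠ end₂
      .adjacent : Adj end₁ end₂

  size : ℕ
  size = length (filter (λ (u , v) → (u <ᶠ? v) ×-dec adj? u v)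
                        (cartesianProduct (allFin order) (allFin order)))

  edgeBetween : ∀ u v → Adj u v → Edge
  edgeBetween u v a with <-cmp u v
  ... | tri< u<v _ _ = edge u v u<v a
  ... | tri≈ _ u≡v _ = ⊥-elim (irrefl u≡v a)
  ... | tri> _ _ v<u = edge v u v<u (symm a)

open Graph public using (Vertex; Edge)

module _ (G : Graph) where
  open Graph G hiding (Vertex; Edge)

  TotalLabeling : Set
  TotalLabeling = (Vertex G ⊎ Edge G) ⤖ Fin (order + size)

module _ {G : Graph} (f : TotalLabeling G) where
  open Graph G hiding (Vertex; Edge)
  open Graph.Edge using (end₁; end₂)

  -- Fin (p + q) is {0, …, p + q - 1}; labels start at 1.
  label : Vertex G ⊎ Edge G → ℕ
  label x = suc (toℕ (Bijection.to f x))

  vlabel : Vertex G → ℕ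
  vlabel v = label (inj₁ v)

  elabel : Edge G → ℕ
  elabel e = label (inj₂ e)

  edgeWeight : Edge G → ℕ
  edgeWeight e = vlabel (end₁ e) + elabel e + vlabel (end₂ e)

  -- The label of the edge vu when u is a neighbor of v, and 0 otherwise.
  neighborTerm : ∀ v u → Dec (Adj v u) → ℕ
  neighborTerm v u (yes a) = elabel (edgeBetween v u a)
  neighborTerm v u (no  _) = 0

  vertexWeight : Vertex G → ℕ
  vertexWeight v =
    vlabel v + sum (map (λ u → neighborTerm v u (adj? v u)) (allFin order))

  Super : Set
  Super = ∀ k → (∃ λ v → vlabel v ≡ k) ⇔ (1 ≤ k × k ≤ order)

  EdgeAntimagic : Set
  EdgeAntimagic = Injective _≡_ _≡_ edgeWeight

  VertexAntimagic : Set
  VertexAntimagic = Injective _≡_ _≡_ vertexWeight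

  TotallyAntimagic : Set
  TotallyAntimagic = EdgeAntimagic × VertexAntimagic

  OrderedOn : Subset order → Set
  OrderedOn S = ∀ u v → u ∈ S → v ∈ S →
                vlabel u < vlabel v → vertexWeight u ≤ vertexWeight v

  IsPartition : ∀ {k} → (Fin k → Subset order) → Set
  IsPartition S = (∀ i → Nonempty (S i)) × (∀ v → ∃! _≡_ λ i → v ∈ S i)

  -- k is existentially quantified; taking all parts to be singletons is allowed.
  WeakOrdered : Set
  WeakOrdered = ∃ λ k → 0 < k × ∃ λ (S : Fin k → Subset order) →
                IsPartition S × (∀ i → OrderedOn (S i))

IsWeakOrderedSuperTAT : Graph → Set
IsWeakOrderedSuperTAT G =
  ∃ λ (f : TotalLabeling G) → WeakOrdered f × Super f × TotallyAntimagic f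

module _ {A B : Set} where

  OppositeSides : Rel (A ⊎ B) 0ℓ
  OppositeSides (inj₁ _) (inj₁ _) = ⊥
  OppositeSides (inj₁ _) (inj₂ _) = ⊤
  OppositeSides (inj₂ _) (inj₁ _) = ⊤
  OppositeSides (inj₂ _) (inj₂ _) = ⊥

  oppositeSides? : Decidable OppositeSides
  oppositeSides? (inj₁ _) (inj₁ _) = no λ ()
  oppositeSides? (inj₁ _) (inj₂ _) = yes tt
  oppositeSides? (inj₂ _) (inj₁ _) = yes tt
  oppositeSides? (inj₂ _) (inj₂ _) = no λ ()

  oppositeSides-sym : Symmetric OppositeSides
  oppositeSides-sym {inj₁ _} {inj₂ _} _ = tt
  oppositeSides-sym {inj₂ _} {inj₁ _} _ = tt

  oppositeSides-irrefl : Irreflexive _≡_ OppositeSides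
  oppositeSides-irrefl {inj₁ _} refl ()
  oppositeSides-irrefl {inj₂ _} refl ()

-- The first m vertices form one partite set, the last n the other.
completeBipartite : ℕ → ℕ → Graph
completeBipartite m n = record
  { order  = m + n
  ; Adj    = OppositeSides on splitAt m
  ; adj?   = λ u v → oppositeSides? (splitAt m u) (splitAt m v)
  ; symm   = λ {u} {v} → oppositeSides-sym {x = splitAt m u} {splitAt m v}
  ; irrefl = λ { {u} refl → oppositeSides-irrefl {x = splitAt m u} refl }
  }

{-# OPTIONS --safe #-}
module Submission where

-- With indices from 0, label the i-th left vertex 2i + 1, the j-th right vertex
-- 2(n - 1 - j) + 2, and the edge between them 2n + 1 + ni + j.  The edge weight
-- is then a constant plus (n + 2)i + (n - 1 - j), which determines i and j.
-- Vertex weights increase by n² + 2 along the left side and by n - 2 along the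
-- right side.  A left and a right weight could only agree when 2i + 1 = n, and
-- there agreement would mean 2j = n(j + 1 - i), which is impossible for n > 3.
-- Weak orderedness holds for the partition into singletons.

open import Defs
open import Data.Fin using (Fin; zero; suc; toℕ; cast; combine; opposite; splitAt; _↑ˡ_; _↑ʳ_; fromℕ<)
import Data.Fin as Fin
import Data.Fin.Properties as Fin
open import Data.Fin.Properties using
  ( +↔⊎; *↔×; toℕ-injective; toℕ<n; toℕ-↑ˡ; toℕ-↑ʳ; toℕ-cast
  ; toℕ-combine; combine-injective; toℕ-fromℕ<; cast-involutive
  ; splitAt-↑ˡ; splitAt-↑ʳ; splitAt⁻¹-↑ˡ; splitAt⁻¹-↑ʳ; ↑ˡ-injective; ↑ʳ-injective
  ; opposite-prop; opposite-involutive)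
open import Data.Fin.Subset using (⁅_⁆)
open import Data.Fin.Subset.Properties using (x∈⁅x⁆; x∈⁅y⁆⇒x≡y)
open import Data.List.Base using (List; []; _∷_; _++_; length; map; filter; allFin; cartesianProduct; tabulate)
open import Data.List.Properties using (length-map; length-tabulate; map-tabulate; length-++)
open import Data.List.Membership.Propositional using (_∈_)
open import Data.List.Membership.Propositional.Properties
  using (∈-filter⁺; ∈-filter⁻; ∈-cartesianProduct⁺; ∈-allFin; ∈-map⁺; ∈-map⁻)
open import Data.List.Membership.Propositional.Properties.WithK using (unique∧set⇒bag)
open import Data.List.Relation.Binary.BagAndSetEquality using (∼bag⇒↭)
open import Data.List.Relation.Binary.Permutation.Propositional.Properties using (↭-length)
import Data.List.Relation.Unary.Unique.Propositional.Properties as Unique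
open import Data.Nat
open import Data.Nat.ListAction using (sum)
open import Data.Nat.Properties
open import Data.Nat.Tactic.RingSolver using (solve-∀)
open import Data.Product using (∃₂; _×_; _,_; proj₁; proj₂)
open import Data.Sum.Base using (_⊎_; inj₁; inj₂)
open import Data.Sum.Function.Propositional using (_⊎-↔_)
open import Data.Unit.Base using (tt)
open import Data.Empty using (⊥-elim-irr)
open import Function.Base using (_∘_; id)
open import Function.Bundles using (_↔_; mk↔ₛ′; mk⇔; Inverse)
open import Function.Properties.Inverse using (↔⇒⤖; ↔-sym; ↔-trans)
open import Relation.Binary.Definitions using (tri<; tri≈; tri>)
open import Relation.Binary.PropositionalEquality
open import Relation.Nullary using (¬_; Dec; yes; no; contradiction)
open import Relation.Nullary.Decidable using (_×-dec_)

-- Arithmetic separating left from right vertex weights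

-- Reduces a strict inequality to a ring identity: once the gap `d` is written out, the solver can
-- check that one side is `suc (y + d)`.
≡⇒≢suc-+ : ∀ {x y} d → x ≡ y → x ≢ suc (y + d)
≡⇒≢suc-+ {y = y} d refl eq = m≢1+m+n y eq

-- Here `i` is one less than the row index, so `n` is still twice the row index plus one. The right
-- side is larger, by `1 + d + 2 * i * d`.
middleRow-above : ∀ i d → let n = 3 + 2 * i ; j = suc i + d in
                  n * suc i + 2 * j ≢ n * (1 + j)
middleRow-above i zero eq = ≡⇒≢suc-+ 0 (sym eq) (lemma i)
  where
  lemma : ∀ i → (3 + 2 * i) * (1 + (suc i + 0)) ≡
                suc ((3 + 2 * i) * suc i + 2 * (suc i + 0) + 0)
  lemma = solve-∀
middleRow-above i (suc d) eq = ≡⇒≢suc-+ (1 + 2 * i + d + 2 * (i * d)) (sym eq) (lemma i d)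
  where
  lemma : ∀ i d → (3 + 2 * i) * (1 + (suc i + suc d)) ≡
          suc ((3 + 2 * i) * suc i + 2 * (suc i + suc d) + (1 + 2 * i + d + 2 * (i * d)))
  lemma = solve-∀

-- The left side exceeds the right by `n * d + 2 * j`. This vanishes only for `j = d = 0`, that is
-- for `i = 1` and `n = 3`, which the hypothesis excludes. The clauses treat `j > 0` and `d > 0`
-- separately to exhibit a positive gap.
middleRow-below : ∀ j d → 1 < suc (j + d) → let i = suc (j + d) ; n = 1 + 2 * i in
                  n * i + 2 * j ≢ n * (1 + j)
middleRow-below zero    zero    (s≤s ()) eq
middleRow-below (suc j) d       _ eq = ≡⇒≢suc-+ (1 + 2 * j + (1 + 2 * suc (suc j + d)) * d) eq (lemma j d)
  where
  lemma : ∀ j d → let i = suc (suc j + d) ; n = 1 + 2 * i in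
          n * i + 2 * suc j ≡ suc (n * (1 + suc j) + (1 + 2 * j + n * d))
  lemma = solve-∀
middleRow-below zero    (suc d) _ eq = ≡⇒≢suc-+ (2 * suc (suc d) + (1 + 2 * suc (suc d)) * d) eq (lemma d)
  where
  lemma : ∀ d → let i = suc (suc d) ; n = 1 + 2 * i in
          n * i + 2 * 0 ≡ suc (n * 1 + (2 * i + n * d))
  lemma = solve-∀

middleRow : ∀ i j → 1 < i → let n = 1 + 2 * i in n * i + 2 * j ≢ n * (1 + j)
middleRow i j 1<i eq with ≤-<-connex i j
middleRow (suc i) j 1<i eq | inj₁ i≤j with d , refl ← m≤n⇒∃[o]m+o≡n i≤j =
  middleRow-above i d (subst (λ n → n * suc i + 2 * (suc i + d) ≡ n * (1 + (suc i + d))) (lemma i) eq)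
  where
  lemma : ∀ i → 1 + 2 * suc i ≡ 3 + 2 * i
  lemma = solve-∀
middleRow i j 1<i eq | inj₂ j<i with d , refl ← m≤n⇒∃[o]m+o≡n j<i = middleRow-below j d 1<i eq

-- The two sides are the doubled weights of the i-th vertex on the left and of
-- the j-th on the right, up to common terms; j′ = n ∸ 1 ∸ j.
module _ (n i j j′ : ℕ) (j+j′ : suc (j + j′) ≡ n) (3<n : 3 < n) where

  private
    lhs rhs : ℕ
    lhs = 4 * i + n * n * (2 * i + 2)
    rhs = 2 + 4 * j′ + 2 * n * j + n * n * n + n

  -- The leading terms satisfy `n * n * (2 * i + 2) ≤ n * n * n`. The remaining `4 * i` is split
  -- into two halves `2 * i < n`: one is absorbed by the summand `n` of `rhs`, the other by
  -- `2 + 4 * j′ + 2 * n * j`, which is at least `1 + j′ + j = n`.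
  smallRow-< : 2 * i + 2 ≤ n → lhs < rhs
  smallRow-< 2i+2≤n = begin-strict
    4 * i + n * n * (2 * i + 2)                ≤⟨ +-monoʳ-≤ (4 * i) (*-monoʳ-≤ (n * n) 2i+2≤n) ⟩
    4 * i + n * n * n                          ≡⟨ lemma₁ i (n * n * n) ⟩
    2 * i + (n * n * n + 2 * i)                <⟨ +-mono-≤-< 2i≤ (+-monoʳ-< (n * n * n) 2i<n) ⟩
    2 + 4 * j′ + 2 * n * j + (n * n * n + n)   ≡⟨ +-assoc (2 + 4 * j′ + 2 * n * j) (n * n * n) n ⟨
    rhs                                        ∎
    where
    open ≤-Reasoning
    lemma₁ : ∀ i c → 4 * i + c ≡ 2 * i + (c + 2 * i)
    lemma₁ = solve-∀
    2i<n : 2 * i < n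
    2i<n = <-≤-trans (m<m+n (2 * i) (s≤s z≤n)) 2i+2≤n
    lemma₂ : ∀ j j′ → suc (j + j′) ≡ 1 + j′ + j
    lemma₂ = solve-∀
    2i≤ : 2 * i ≤ 2 + 4 * j′ + 2 * n * j
    2i≤ = begin
      2 * i                   ≤⟨ <⇒≤ 2i<n ⟩
      n                       ≡⟨ j+j′ ⟨
      suc (j + j′)            ≡⟨ lemma₂ j j′ ⟩
      1 + j′ + j              ≤⟨ +-mono-≤ (+-mono-≤ (n≤1+n 1) (m≤n*m j′ 4))
                                   (m≤n*m j (2 * n) ⦃ >-nonZero (<-≤-trans (s≤s z≤n) (≤-trans (<⇒≤ 3<n) (m≤n*m n 2))) ⦄) ⟩
      2 + 4 * j′ + 2 * n * j  ∎

  largeRow-distinct : n ≤ 2 * i → lhs ≢ rhs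
  largeRow-distinct n≤2i eq with d , n+d≡2i ← m≤n⇒∃[o]m+o≡n n≤2i
                            | q , 4+q≡n ← m≤n⇒∃[o]m+o≡n 3<n =
    -- The factor `4 + 2 * q` is `2 * n ∸ 4`. Adding `2 * n + (4 + 2 * q) * j′` to `rhs` turns its
    -- dependence on `j` and `j′` into `2 * n * suc (j + j′)`, hence into a function of `n` alone.
    -- The same addition leaves `lhs` strictly above that value.
    ≡⇒≢suc-+ (9 + 3 * q + 2 * d + n * n * d + (4 + 2 * q) * j′)
      (trans (cong (λ l → l + (2 * n + (4 + 2 * q) * j′)) eq) rhs-bound) lhs-bound
    where
    open ≡-Reasoning
    rhs-bound : rhs + (2 * n + (4 + 2 * q) * j′) ≡ 2 + 2 * n * n + n * n * n + n
    rhs-bound = begin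
      rhs + (2 * n + (4 + 2 * q) * j′)                         ≡⟨ lemma₁ n j j′ q ⟩
      2 + 2 * n * j + n * n * n + n + (2 * n + 2 * (4 + q) * j′) ≡⟨ cong (λ m → 2 + 2 * n * j + n * n * n + n + (2 * n + 2 * m * j′)) 4+q≡n ⟩
      2 + 2 * n * j + n * n * n + n + (2 * n + 2 * n * j′)     ≡⟨ lemma₂ n j j′ ⟩
      2 + 2 * n * suc (j + j′) + n * n * n + n                 ≡⟨ cong (λ m → 2 + 2 * n * m + n * n * n + n) j+j′ ⟩
      2 + 2 * n * n + n * n * n + n                            ∎
      where
      lemma₁ : ∀ n j j′ q → 2 + 4 * j′ + 2 * n * j + n * n * n + n + (2 * n + (4 + 2 * q) * j′) ≡
               2 + 2 * n * j + n * n * n + n + (2 * n + 2 * (4 + q) * j′)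
      lemma₁ = solve-∀
      lemma₂ : ∀ n j j′ → 2 + 2 * n * j + n * n * n + n + (2 * n + 2 * n * j′) ≡
               2 + 2 * n * suc (j + j′) + n * n * n + n
      lemma₂ = solve-∀
    lhs-bound : lhs + (2 * n + (4 + 2 * q) * j′) ≡
                suc (2 + 2 * n * n + n * n * n + n + (9 + 3 * q + 2 * d + n * n * d + (4 + 2 * q) * j′))
    lhs-bound = begin
      lhs + (2 * n + (4 + 2 * q) * j′)
        ≡⟨ lemma₁ n i (2 * n + (4 + 2 * q) * j′) ⟩
      2 * (2 * i) + n * n * (2 * i + 2) + (2 * n + (4 + 2 * q) * j′)
        ≡⟨ cong (λ m → 2 * m + n * n * (m + 2) + (2 * n + (4 + 2 * q) * j′)) n+d≡2i ⟨
      2 * (n + d) + n * n * (n + d + 2) + (2 * n + (4 + 2 * q) * j′)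
        ≡⟨ lemma₂ n d ((4 + 2 * q) * j′) ⟩
      3 * n + (2 * n * n + n * n * n + n + (2 * d + n * n * d + (4 + 2 * q) * j′))
        ≡⟨ cong (λ m → 3 * m + (2 * n * n + n * n * n + n + (2 * d + n * n * d + (4 + 2 * q) * j′))) 4+q≡n ⟨
      3 * (4 + q) + (2 * n * n + n * n * n + n + (2 * d + n * n * d + (4 + 2 * q) * j′))
        ≡⟨ lemma₃ n d q ((4 + 2 * q) * j′) ⟩
      suc (2 + 2 * n * n + n * n * n + n + (9 + 3 * q + 2 * d + n * n * d + (4 + 2 * q) * j′)) ∎
      where
      lemma₁ : ∀ n i c → 4 * i + n * n * (2 * i + 2) + c ≡ 2 * (2 * i) + n * n * (2 * i + 2) + c
      lemma₁ = solve-∀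
      lemma₂ : ∀ n d c → 2 * (n + d) + n * n * (n + d + 2) + (2 * n + c) ≡
               3 * n + (2 * n * n + n * n * n + n + (2 * d + n * n * d + c))
      lemma₂ = solve-∀
      lemma₃ : ∀ n d q c → 3 * (4 + q) + (2 * n * n + n * n * n + n + (2 * d + n * n * d + c)) ≡
               suc (2 + 2 * n * n + n * n * n + n + (9 + 3 * q + 2 * d + n * n * d + c))
      lemma₃ = solve-∀

-- After adding `4 * j` to both sides, `j′` occurs only in `j + j′`, which is `2 * i`. Cancelling
-- `C` and halving leaves the equation refuted by `middleRow`.
middleRow-distinct : ∀ i j j′ → let n = 1 + 2 * i in suc (j + j′) ≡ n → 3 < n →
                     4 * i + n * n * (2 * i + 2) ≢ 2 + 4 * j′ + 2 * n * j + n * n * n + n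
middleRow-distinct i j j′ j+j′ 3<n eq = middleRow i j (*-cancelˡ-< 2 1 i (s≤s⁻¹ 3<n)) reduced
  where
  open ≡-Reasoning
  n = 1 + 2 * i
  C = n * n * n + n + 4 * i
  lemma₁ : ∀ i j → let n = 1 + 2 * i in n * n * n + n + 4 * i + 2 * (n * i + 2 * j) ≡
           4 * i + n * n * (2 * i + 2) + 4 * j
  lemma₁ = solve-∀
  lemma₂ : ∀ n j j′ → 2 + 4 * j′ + 2 * n * j + n * n * n + n + 4 * j ≡
           2 + 4 * (j + j′) + 2 * n * j + n * n * n + n
  lemma₂ = solve-∀
  lemma₃ : ∀ i j → let n = 1 + 2 * i in
           2 + 4 * (2 * i) + 2 * n * j + n * n * n + n ≡ n * n * n + n + 4 * i + 2 * (n * (1 + j))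
  lemma₃ = solve-∀
  reduced : n * i + 2 * j ≡ n * (1 + j)
  reduced = *-cancelˡ-≡ _ _ 2 (+-cancelˡ-≡ C _ _ (begin
    C + 2 * (n * i + 2 * j)                              ≡⟨ lemma₁ i j ⟩
    4 * i + n * n * (2 * i + 2) + 4 * j                  ≡⟨ cong (_+ 4 * j) eq ⟩
    2 + 4 * j′ + 2 * n * j + n * n * n + n + 4 * j       ≡⟨ lemma₂ n j j′ ⟩
    2 + 4 * (j + j′) + 2 * n * j + n * n * n + n         ≡⟨ cong (λ m → 2 + 4 * m + 2 * n * j + n * n * n + n) (suc-injective j+j′) ⟩
    2 + 4 * (2 * i) + 2 * n * j + n * n * n + n          ≡⟨ lemma₃ i j ⟩
    C + 2 * (n * (1 + j))                                ∎))

-- Arrange the edge labels in an `n` by `n` array: left vertices collect rows, right vertices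
-- collect columns. Rows before the middle one weigh less than every column, rows after it more, and
-- the middle row `1 + 2 * i ≡ n` needs the exact computation.
row≢column : ∀ n i j j′ → suc (j + j′) ≡ n → 3 < n →
             4 * i + n * n * (2 * i + 2) ≢ 2 + 4 * j′ + 2 * n * j + n * n * n + n
row≢column n i j j′ j+j′ 3<n eq with <-cmp (1 + 2 * i) n
... | tri< 2i+1<n _ _ = <⇒≢ (smallRow-< n i j j′ j+j′ 3<n (subst (_≤ n) (+-comm 2 (2 * i)) 2i+1<n)) eq
... | tri≈ _ refl _   = middleRow-distinct i j j′ j+j′ 3<n eq
... | tri> _ _ n<2i+1 = largeRow-distinct n i j j′ j+j′ 3<n (s≤s⁻¹ n<2i+1) eq

-- Sums over finite index ranges and triangular numbers

sum-tabulate-cong : ∀ {n} {f g : Fin n → ℕ} → (∀ i → f i ≡ g i) →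
                    sum (tabulate f) ≡ sum (tabulate g)
sum-tabulate-cong {zero}  f≗g = refl
sum-tabulate-cong {suc n} f≗g = cong₂ _+_ (f≗g zero) (sum-tabulate-cong (f≗g ∘ suc))

sum-tabulate-+ : ∀ m {n} (f : Fin (m + n) → ℕ) →
                 sum (tabulate f) ≡ sum (tabulate (f ∘ (_↑ˡ n))) + sum (tabulate (f ∘ (m ↑ʳ_)))
sum-tabulate-+ zero    f = refl
sum-tabulate-+ (suc m) f =
  trans (cong (f zero +_) (sum-tabulate-+ m (f ∘ suc))) (sym (+-assoc (f zero) _ _))

-- Edge labels are affine in the index along a row (slope 1) and along a column (slope `n`), so this
-- evaluates both kinds of sum.
sum-tabulate-affine : ∀ {n} c d (g : Fin n → ℕ) →
                      sum (tabulate (λ i → c + d * g i)) ≡ n * c + d * sum (tabulate g)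
sum-tabulate-affine {zero}  c d g = sym (*-zeroʳ d)
sum-tabulate-affine {suc n} c d g =
  trans (cong (c + d * g zero +_) (sum-tabulate-affine c d (g ∘ suc)))
        (lemma c d n (g zero) (sum (tabulate (g ∘ suc))))
  where
  lemma : ∀ c d n x s → c + d * x + (n * c + d * s) ≡ c + n * c + d * (x + s)
  lemma = solve-∀

sum-tabulate-const : ∀ n c → sum (tabulate {n = n} (λ _ → c)) ≡ n * c
sum-tabulate-const zero    c = refl
sum-tabulate-const (suc n) c = cong (c +_) (sum-tabulate-const n c)

triangle : ℕ → ℕ
triangle n = sum (tabulate {n = n} toℕ)

-- The sum runs from 0 to `n - 1`, so its closed form is n(n - 1)/2; this form of it avoids both
-- division and truncated subtraction.
triangle-doubled : ∀ n → 2 * triangle n + n ≡ n * n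
triangle-doubled zero    = refl
triangle-doubled (suc n) = begin
  2 * sum (tabulate {n = n} (suc ∘ toℕ)) + suc n
    ≡⟨ cong (λ s → 2 * s + suc n) (sum-tabulate-cong {n} (λ i → cong suc (sym (*-identityˡ (toℕ i))))) ⟩
  2 * sum (tabulate {n = n} (λ i → 1 + 1 * toℕ i)) + suc n
    ≡⟨ cong (λ s → 2 * s + suc n) (sum-tabulate-affine {n} 1 1 toℕ) ⟩
  2 * (n * 1 + 1 * triangle n) + suc n  ≡⟨ lemma₁ n (triangle n) ⟩
  2 * triangle n + n + (n + n + 1)      ≡⟨ cong (_+ (n + n + 1)) (triangle-doubled n) ⟩
  n * n + (n + n + 1)                   ≡⟨ lemma₂ n ⟩
  suc n * suc n                         ∎
  where
  open ≡-Reasoning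
  lemma₁ : ∀ n t → 2 * (n * 1 + 1 * t) + suc n ≡ 2 * t + n + (n + n + 1)
  lemma₁ = solve-∀
  lemma₂ : ∀ n → n * n + (n + n + 1) ≡ suc n * suc n
  lemma₂ = solve-∀

-- Finite products, reversal of indices and monotone functions

length-cartesianProduct : ∀ {A B : Set} (xs : List A) (ys : List B) →
                          length (cartesianProduct xs ys) ≡ length xs * length ys
length-cartesianProduct []       ys = refl
length-cartesianProduct (x ∷ xs) ys = begin
  length (map (x ,_) ys ++ cartesianProduct xs ys)
    ≡⟨ length-++ (map (x ,_) ys) ⟩
  length (map (x ,_) ys) + length (cartesianProduct xs ys)
    ≡⟨ cong₂ _+_ (length-map (x ,_) ys) (length-cartesianProduct xs ys) ⟩
  length ys + length xs * length ys ∎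
  where open ≡-Reasoning

cast-↔ : ∀ {m n} → m ≡ n → Fin m ↔ Fin n
cast-↔ eq = mk↔ₛ′ (cast eq) (cast (sym eq))
                  (cast-involutive eq (sym eq)) (cast-involutive (sym eq) eq)

-- `opposite j` has index `n ∸ 1 ∸ j`; the additive form is the one usable in semiring identities.
toℕ-opposite : ∀ {n} (j : Fin n) → suc (toℕ j + toℕ (opposite j)) ≡ n
toℕ-opposite {n} j = trans (cong (suc (toℕ j) +_) (opposite-prop j)) (m+[n∸m]≡n (toℕ<n j))

strictlyMonotone⇒injective : ∀ {n} (w : Fin n → ℕ) → (∀ {i k} → toℕ i < toℕ k → w i < w k) →
                             ∀ i k → w i ≡ w k → i ≡ k
strictlyMonotone⇒injective w mono i k eq with <-cmp (toℕ i) (toℕ k)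
... | tri< i<k _ _ = contradiction eq (<⇒≢ (mono i<k))
... | tri≈ _ i≡k _ = toℕ-injective i≡k
... | tri> _ _ k<i = contradiction (sym eq) (<⇒≢ (mono k<i))

-- Labelings of an arbitrary graph

module _ {G : Graph} (f : TotalLabeling G) where

  -- Two members of a singleton coincide, so neither label is smaller and the order condition is
  -- vacuous. The hypothesis makes the number of parts positive.
  weakOrdered-singletons : 0 < Graph.order G → WeakOrdered f
  weakOrdered-singletons 0<p =
    Graph.order G , 0<p , ⁅_⁆ ,
    ((λ i → i , x∈⁅x⁆ i) , (λ v → v , x∈⁅x⁆ v , λ {w} v∈⁅w⁆ → x∈⁅y⁆⇒x≡y w v∈⁅w⁆)) ,
    λ i u v u∈⁅i⁆ v∈⁅i⁆ fu<fv →
      contradiction fu<fv (<-irrefl (cong (vlabel f) (trans (x∈⁅y⁆⇒x≡y i u∈⁅i⁆) (sym (x∈⁅y⁆⇒x≡y i v∈⁅i⁆)))))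

  -- The decision `d` is arbitrary because `adj?` need not reduce at the vertices concerned.
  -- Splitting on it yields an unknown adjacency proof, hence the assumption for every `a`.
  neighborTerm-adjacent : ∀ v u (d : Dec (Graph.Adj G v u)) {e} →
                          (∀ a → Graph.edgeBetween G v u a ≡ e) → Graph.Adj G v u →
                          neighborTerm f v u d ≡ elabel f e
  neighborTerm-adjacent v u (yes a) all≡e _ = cong (elabel f) (all≡e a)
  neighborTerm-adjacent v u (no ¬a) _     a = contradiction a ¬a

  neighborTerm-nonadjacent : ∀ v u (d : Dec (Graph.Adj G v u)) → ¬ Graph.Adj G v u →
                             neighborTerm f v u d ≡ 0
  neighborTerm-nonadjacent v u (yes a) ¬a = contradiction a ¬a
  neighborTerm-nonadjacent v u (no _)  _  = refl

-- Vertices and edges of the complete bipartite graph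

module CompleteBipartite (n : ℕ) where

  G : Graph
  G = completeBipartite n n

  open Graph G public using (order; size; Adj; adj?; edgeBetween)

  left right : Fin n → Fin (n + n)
  left i  = i ↑ˡ n
  right j = n ↑ʳ j

  data Side : Fin (n + n) → Set where
    isLeft  : ∀ i → Side (left i)
    isRight : ∀ j → Side (right j)

  side : ∀ v → Side v
  side v with splitAt n v in eq
  ... | inj₁ i = subst Side (splitAt⁻¹-↑ˡ eq) (isLeft i)
  ... | inj₂ j = subst Side (splitAt⁻¹-↑ʳ eq) (isRight j)

  left~right : ∀ i j → Adj (left i) (right j)
  left~right i j rewrite splitAt-↑ˡ n i n | splitAt-↑ʳ n n j = tt

  right~left : ∀ j i → Adj (right j) (left i)
  right~left j i rewrite splitAt-↑ˡ n i n | splitAt-↑ʳ n n j = tt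

  left≁left : ∀ i k → ¬ Adj (left i) (left k)
  left≁left i k rewrite splitAt-↑ˡ n i n | splitAt-↑ˡ n k n = λ ()

  right≁right : ∀ j k → ¬ Adj (right j) (right k)
  right≁right j k rewrite splitAt-↑ʳ n n j | splitAt-↑ʳ n n k = λ ()

  left<right : ∀ i j → left i Fin.< right j
  left<right i j rewrite toℕ-↑ˡ i n | toℕ-↑ʳ n j = <-≤-trans (toℕ<n i) (m≤m+n n _)

  cross : Fin n → Fin n → Edge G
  cross i j = Graph.edge (left i) (right j) (left<right i j) (left~right i j)

  cross-injective : ∀ {i j k l} → cross i j ≡ cross k l → (i , j) ≡ (k , l)
  cross-injective {i} {j} {k} {l} eq =
    cong₂ _,_ (↑ˡ-injective n i k (cong Graph.Edge.end₁ eq)) (↑ʳ-injective n j l (cong Graph.Edge.end₂ eq))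

  -- Adjacency forces the endpoints onto opposite sides, and since left indices precede right ones,
  -- the increasing order puts the left endpoint first.
  cross-surjective : ∀ e → ∃₂ λ i j → cross i j ≡ e
  cross-surjective (Graph.edge u v u<v u~v) = go (side u) (side v) u<v u~v
    where
    go : ∀ {u v} → Side u → Side v → .(u<v : u Fin.< v) .(u~v : Adj u v) →
         ∃₂ λ i j → cross i j ≡ Graph.edge u v u<v u~v
    -- `refl` suffices because the order and adjacency proofs in an edge are irrelevant; for the
    -- same reason the contradictions below use `⊥-elim-irr`.
    go (isLeft i)  (isRight j) _   _   = i , j , refl
    go (isLeft i)  (isLeft k)  _   u~v = ⊥-elim-irr (left≁left i k u~v)
    go (isRight j) (isRight k) _   u~v = ⊥-elim-irr (right≁right j k u~v)
    go (isRight j) (isLeft i)  u<v _   = ⊥-elim-irr (<-asym u<v (left<right i j))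

  edgeBetween-left-right : ∀ i j a → edgeBetween (left i) (right j) a ≡ cross i j
  edgeBetween-left-right i j a with Fin.<-cmp (left i) (right j)
  ... | tri< _ _ _   = refl
  ... | tri≈ ¬lt _ _ = contradiction (left<right i j) ¬lt
  ... | tri> ¬lt _ _ = contradiction (left<right i j) ¬lt

  edgeBetween-right-left : ∀ i j a → edgeBetween (right j) (left i) a ≡ cross i j
  edgeBetween-right-left i j a with Fin.<-cmp (right j) (left i)
  ... | tri< _ _ ¬gt = contradiction (left<right i j) ¬gt
  ... | tri≈ _ _ ¬gt = contradiction (left<right i j) ¬gt
  ... | tri> _ _ _   = refl

  edge-↔ : Edge G ↔ (Fin n × Fin n)
  edge-↔ = mk↔ₛ′ coordinates (λ (i , j) → cross i j)
    (λ (i , j) → cross-injective (cross-coordinates (cross i j))) cross-coordinates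
    where
    coordinates : Edge G → Fin n × Fin n
    coordinates e = let i , j , _ = cross-surjective e in i , j
    cross-coordinates : ∀ e → let (i , j) = coordinates e in cross i j ≡ e
    cross-coordinates e = proj₂ (proj₂ (cross-surjective e))

  -- The filtered list of pairs and the list of endpoints of all `cross i j` are both free of
  -- duplicates and have the same members, so one is a permutation of the other.
  size≡n*n : size ≡ n * n
  size≡n*n = begin
    size                                                ≡⟨ ↭-length (∼bag⇒↭ (unique∧set⇒bag unique-filter unique-cross (mk⇔ to from))) ⟩
    length (map endpoints (cartesianProduct (allFin n) (allFin n)))   ≡⟨ length-map endpoints (cartesianProduct (allFin n) (allFin n)) ⟩
    length (cartesianProduct (allFin n) (allFin n))     ≡⟨ length-cartesianProduct (allFin n) (allFin n) ⟩
    length (allFin n) * length (allFin n)               ≡⟨ cong₂ _*_ (length-tabulate {n = n} id) (length-tabulate {n = n} id) ⟩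
    n * n                                               ∎
    where
    open ≡-Reasoning
    endpoints : Fin n × Fin n → Fin (n + n) × Fin (n + n)
    endpoints (i , j) = left i , right j
    IsEdge : Fin (n + n) × Fin (n + n) → Set
    IsEdge (u , v) = u Fin.< v × Adj u v
    isEdge? : ∀ uv → Dec (IsEdge uv)
    isEdge? (u , v) = (u Fin.<? v) ×-dec adj? u v
    allPairs = cartesianProduct (allFin (n + n)) (allFin (n + n))
    unique-filter = Unique.filter⁺ isEdge? (Unique.cartesianProduct⁺ (Unique.allFin⁺ (n + n)) (Unique.allFin⁺ (n + n)))
    unique-cross = Unique.map⁺ {f = endpoints}
      (λ {(i , j)} {(k , l)} eq → cong₂ _,_ (↑ˡ-injective n i k (cong proj₁ eq)) (↑ʳ-injective n j l (cong proj₂ eq)))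
      (Unique.cartesianProduct⁺ (Unique.allFin⁺ n) (Unique.allFin⁺ n))
    to : ∀ {uv} → uv ∈ filter isEdge? allPairs → uv ∈ map endpoints (cartesianProduct (allFin n) (allFin n))
    to {u , v} uv∈ with _ , u<v , u~v ← ∈-filter⁻ isEdge? {xs = allPairs} uv∈
      with i , j , refl ← cross-surjective (Graph.edge u v u<v u~v) =
      ∈-map⁺ endpoints (∈-cartesianProduct⁺ (∈-allFin i) (∈-allFin j))
    from : ∀ {uv} → uv ∈ map endpoints (cartesianProduct (allFin n) (allFin n)) → uv ∈ filter isEdge? allPairs
    from uv∈ with (i , j) , _ , refl ← ∈-map⁻ endpoints uv∈ =
      ∈-filter⁺ isEdge? (∈-cartesianProduct⁺ (∈-allFin (left i)) (∈-allFin (right j)))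
                (left<right i j , left~right i j)

  -- The labeling and its values

  -- The `Fin 2` component becomes the last binary digit of the label minus one: left labels are
  -- odd, right labels even. Reversing the right side makes `j` enter edge weights with coefficient
  -- 1 - 2 = -1, so it spans only `n` consecutive values.
  interleave-↔ : (Fin n ⊎ Fin n) ↔ (Fin n × Fin 2)
  interleave-↔ = mk↔ₛ′ to from to∘from from∘to
    where
    to : Fin n ⊎ Fin n → Fin n × Fin 2
    to (inj₁ i) = i , zero
    to (inj₂ j) = opposite j , suc zero
    from : Fin n × Fin 2 → Fin n ⊎ Fin n
    from (i , zero)     = inj₁ i
    from (j , suc zero) = inj₂ (opposite j)
    to∘from : ∀ y → to (from y) ≡ y
    to∘from (i , zero)     = refl
    to∘from (j , suc zero) = cong (_, suc zero) (opposite-involutive j)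
    from∘to : ∀ x → from (to x) ≡ x
    from∘to (inj₁ i) = refl
    from∘to (inj₂ j) = cong inj₂ (opposite-involutive j)

  n*2≡n+n : n * 2 ≡ n + n
  n*2≡n+n = lemma n
    where
    lemma : ∀ n → n * 2 ≡ n + n
    lemma = solve-∀

  vertex-↔ : Fin (n + n) ↔ Fin (n + n)
  vertex-↔ = ↔-trans +↔⊎ (↔-trans interleave-↔ (↔-trans (↔-sym *↔×) (cast-↔ n*2≡n+n)))

  -- Vertices occupy the first `n + n` positions; the edges follow row by row, in the order given by
  -- `combine`.
  labeling-↔ : (Vertex G ⊎ Edge G) ↔ Fin (n + n + size)
  labeling-↔ = ↔-trans
    (vertex-↔ ⊎-↔ ↔-trans edge-↔ (↔-trans (↔-sym *↔×) (cast-↔ (sym size≡n*n))))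
    (↔-sym +↔⊎)

  labeling : TotalLabeling G
  labeling = ↔⇒⤖ labeling-↔

  vlabel-vertex-↔ : ∀ v → vlabel {G} labeling v ≡ suc (toℕ (Inverse.to vertex-↔ v))
  vlabel-vertex-↔ v = cong suc (toℕ-↑ˡ (Inverse.to vertex-↔ v) size)

  vlabel-left : ∀ i → vlabel {G} labeling (left i) ≡ 1 + 2 * toℕ i
  vlabel-left i = trans (vlabel-vertex-↔ (left i)) (cong suc lemma)
    where
    open ≡-Reasoning
    lemma : toℕ (Inverse.to vertex-↔ (left i)) ≡ 2 * toℕ i
    lemma rewrite splitAt-↑ˡ n i n = begin
      toℕ (cast n*2≡n+n (combine {n = 2} i zero))     ≡⟨ toℕ-cast n*2≡n+n (combine {n = 2} i zero) ⟩
      toℕ (combine {n = 2} i zero)                ≡⟨ toℕ-combine {n = 2} i zero ⟩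
      2 * toℕ i + 0                       ≡⟨ +-identityʳ (2 * toℕ i) ⟩
      2 * toℕ i                           ∎

  vlabel-right : ∀ j → vlabel {G} labeling (right j) ≡ 2 + 2 * toℕ (opposite j)
  vlabel-right j = trans (vlabel-vertex-↔ (right j)) (cong suc lemma)
    where
    open ≡-Reasoning
    lemma : toℕ (Inverse.to vertex-↔ (right j)) ≡ 1 + 2 * toℕ (opposite j)
    lemma rewrite splitAt-↑ʳ n n j = begin
      toℕ (cast n*2≡n+n (combine {n = 2} (opposite j) (suc zero)))   ≡⟨ toℕ-cast n*2≡n+n (combine {n = 2} (opposite j) (suc zero)) ⟩
      toℕ (combine {n = 2} (opposite j) (suc zero))              ≡⟨ toℕ-combine {n = 2} (opposite j) (suc zero) ⟩
      2 * toℕ (opposite j) + 1                           ≡⟨ +-comm (2 * toℕ (opposite j)) 1 ⟩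
      1 + 2 * toℕ (opposite j)                           ∎

  elabel-cross : ∀ i j → elabel {G} labeling (cross i j) ≡ 1 + (n + n) + (n * toℕ i + toℕ j)
  elabel-cross i j = cong suc (begin
    toℕ ((n + n) ↑ʳ Inverse.to edges (cross i j))      ≡⟨ toℕ-↑ʳ (n + n) (Inverse.to edges (cross i j)) ⟩
    n + n + toℕ (Inverse.to edges (cross i j))         ≡⟨ cong (n + n +_) (toℕ-cast (sym size≡n*n) _) ⟩
    n + n + toℕ (Inverse.from *↔× (Inverse.to edge-↔ (cross i j)))
      ≡⟨ cong (λ ij → n + n + toℕ (Inverse.from *↔× ij)) (Inverse.strictlyInverseˡ edge-↔ (i , j)) ⟩
    n + n + toℕ (combine i j)                          ≡⟨ cong (n + n +_) (toℕ-combine i j) ⟩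
    n + n + (n * toℕ i + toℕ j)                        ∎)
    where
    open ≡-Reasoning
    edges : Edge G ↔ Fin size
    edges = ↔-trans edge-↔ (↔-trans (↔-sym *↔×) (cast-↔ (sym size≡n*n)))

  -- `vertex-↔` permutes the first `n + n` positions, so the vertex labeled `suc m` is the preimage
  -- of position `m`.
  super : Super {G} labeling
  super k = mk⇔ (λ { (v , refl) → s≤s z≤n , subst (_≤ n + n) (sym (vlabel-vertex-↔ v)) (toℕ<n (Inverse.to vertex-↔ v)) })
                λ { (s≤s {n = m} _ , m<2n) → Inverse.from vertex-↔ (fromℕ< m<2n) ,
                    trans (vlabel-vertex-↔ (Inverse.from vertex-↔ (fromℕ< m<2n)))
                          (cong suc (trans (cong toℕ (Inverse.strictlyInverseˡ vertex-↔ (fromℕ< m<2n))) (toℕ-fromℕ< m<2n))) }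

  -- Edge weights

  -- The weight is a constant plus the two-digit number with digits i and
  -- 2 + (n ∸ 1 ∸ j) in base 2 + n.
  edgeWeight-cross : ∀ i j → edgeWeight {G} labeling (cross i j) ≡
                     1 + 3 * n + toℕ (combine i (suc (suc (opposite j))))
  edgeWeight-cross i j = begin
    vlabel {G} labeling (left i) + elabel {G} labeling (cross i j) + vlabel {G} labeling (right j)
      ≡⟨ cong₂ _+_ (cong₂ _+_ (vlabel-left i) (elabel-cross i j)) (vlabel-right j) ⟩
    1 + 2 * a + (1 + (n + n) + (n * a + b)) + (2 + 2 * b′)
      -- Of the two copies of `b′`, one joins `b` to give the constant `n`; the other stays as part
      -- of the low digit.
      ≡⟨ lemma₁ n a b b′ ⟩
    2 * n + ((2 + n) * a + (2 + b′)) + suc (b + b′) + 1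
      ≡⟨ cong (λ m → 2 * n + ((2 + n) * a + (2 + b′)) + m + 1) (toℕ-opposite j) ⟩
    2 * n + ((2 + n) * a + (2 + b′)) + n + 1
      ≡⟨ lemma₂ n ((2 + n) * a + (2 + b′)) ⟩
    1 + 3 * n + ((2 + n) * a + (2 + b′))
      ≡⟨ cong (1 + 3 * n +_) (toℕ-combine i (suc (suc (opposite j)))) ⟨
    1 + 3 * n + toℕ (combine i (suc (suc (opposite j)))) ∎
    where
    open ≡-Reasoning
    a b b′ : ℕ
    a = toℕ i
    b = toℕ j
    b′ = toℕ (opposite j)
    lemma₁ : ∀ n a b b′ → 1 + 2 * a + (1 + (n + n) + (n * a + b)) + (2 + 2 * b′) ≡
                          2 * n + ((2 + n) * a + (2 + b′)) + suc (b + b′) + 1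
    lemma₁ = solve-∀
    lemma₂ : ∀ n c → 2 * n + c + n + 1 ≡ 1 + 3 * n + c
    lemma₂ = solve-∀

  edgeWeight-injective : ∀ i j k l →
    edgeWeight {G} labeling (cross i j) ≡ edgeWeight {G} labeling (cross k l) → cross i j ≡ cross k l
  edgeWeight-injective i j k l eq = cong₂ cross (proj₁ i≡k×j≡l) j≡l
    where
    i≡k×j≡l : i ≡ k × suc (suc (opposite j)) ≡ suc (suc (opposite l))
    i≡k×j≡l = combine-injective i (suc (suc (opposite j))) k (suc (suc (opposite l)))
      (toℕ-injective (+-cancelˡ-≡ (1 + 3 * n) _ _
        (trans (sym (edgeWeight-cross i j)) (trans eq (edgeWeight-cross k l)))))
    j≡l : j ≡ l
    j≡l = trans (sym (opposite-involutive j))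
                (trans (cong opposite (Fin.suc-injective (Fin.suc-injective (proj₂ i≡k×j≡l))))
                       (opposite-involutive l))

  edgeAntimagic : EdgeAntimagic {G} labeling
  edgeAntimagic {e} {e′} eq =
    let i , j , ij≡e  = cross-surjective e
        k , l , kl≡e′ = cross-surjective e′
        weight        = edgeWeight {G} labeling
    in trans (sym ij≡e) (trans
         (edgeWeight-injective i j k l (trans (cong weight ij≡e) (trans eq (cong weight (sym kl≡e′)))))
         kl≡e′)

  -- Vertex weights

  vertexWeight-split : ∀ v → vertexWeight {G} labeling v ≡
    vlabel {G} labeling v +
    (sum (tabulate (λ i → neighborTerm {G} labeling v (left i) (adj? v (left i)))) +
     sum (tabulate (λ j → neighborTerm {G} labeling v (right j) (adj? v (right j)))))
  vertexWeight-split v = cong (vlabel {G} labeling v +_)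
    (trans (cong sum (map-tabulate {n = n + n} id term)) (sum-tabulate-+ n term))
    where
    term : Fin (n + n) → ℕ
    term u = neighborTerm {G} labeling v u (adj? v u)

  -- The parenthesized term is the sum of row `i` of the edge labels.
  leftWeight : Fin n → ℕ
  leftWeight i = 1 + 2 * toℕ i + (n * (1 + (n + n) + n * toℕ i) + triangle n)

  -- The parenthesized term is the sum of column `j`, where consecutive edge labels differ by `n`.
  rightWeight : Fin n → ℕ
  rightWeight j = 2 + 2 * toℕ (opposite j) + (n * (1 + (n + n) + toℕ j) + n * triangle n)

  vertexWeight-left : ∀ i → vertexWeight {G} labeling (left i) ≡ leftWeight i
  vertexWeight-left i = begin
    vertexWeight {G} labeling (left i)
      ≡⟨ vertexWeight-split (left i) ⟩
    vlabel {G} labeling (left i) + (sum (tabulate term₁) + sum (tabulate term₂))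
      ≡⟨ cong₂ _+_ (vlabel-left i) (cong₂ _+_ (sum-tabulate-cong term₁≡) (sum-tabulate-cong term₂≡)) ⟩
    1 + 2 * toℕ i + (sum (tabulate {n = n} (λ _ → 0)) + sum (tabulate (λ j → 1 + (n + n) + n * toℕ i + 1 * toℕ {n} j)))
      ≡⟨ cong (1 + 2 * toℕ i +_) (cong₂ _+_ (sum-tabulate-const n 0) (sum-tabulate-affine {n} (1 + (n + n) + n * toℕ i) 1 toℕ)) ⟩
    1 + 2 * toℕ i + (n * 0 + (n * (1 + (n + n) + n * toℕ i) + 1 * triangle n))
      ≡⟨ lemma n (1 + 2 * toℕ i) (n * (1 + (n + n) + n * toℕ i)) (triangle n) ⟩
    leftWeight i ∎
    where
    open ≡-Reasoning
    term₁ term₂ : Fin n → ℕ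
    term₁ k = neighborTerm {G} labeling (left i) (left k) (adj? (left i) (left k))
    term₂ j = neighborTerm {G} labeling (left i) (right j) (adj? (left i) (right j))
    term₁≡ : ∀ k → term₁ k ≡ 0
    term₁≡ k = neighborTerm-nonadjacent {G} labeling (left i) (left k) _ (left≁left i k)
    reassociate : ∀ c x y → c + (x + y) ≡ c + x + 1 * y
    reassociate = solve-∀
    term₂≡ : ∀ j → term₂ j ≡ 1 + (n + n) + n * toℕ i + 1 * toℕ j
    term₂≡ j = trans
      (neighborTerm-adjacent {G} labeling (left i) (right j) _ (edgeBetween-left-right i j) (left~right i j))
      (trans (elabel-cross i j) (reassociate (1 + (n + n)) (n * toℕ i) (toℕ j)))
    lemma : ∀ n c x t → c + (n * 0 + (x + 1 * t)) ≡ c + (x + t)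
    lemma = solve-∀

  vertexWeight-right : ∀ j → vertexWeight {G} labeling (right j) ≡ rightWeight j
  vertexWeight-right j = begin
    vertexWeight {G} labeling (right j)
      ≡⟨ vertexWeight-split (right j) ⟩
    vlabel {G} labeling (right j) + (sum (tabulate term₁) + sum (tabulate term₂))
      ≡⟨ cong₂ _+_ (vlabel-right j) (cong₂ _+_ (sum-tabulate-cong term₁≡) (sum-tabulate-cong term₂≡)) ⟩
    2 + 2 * toℕ (opposite j) + (sum (tabulate (λ i → 1 + (n + n) + toℕ j + n * toℕ {n} i)) + sum (tabulate {n = n} (λ _ → 0)))
      ≡⟨ cong (2 + 2 * toℕ (opposite j) +_) (cong₂ _+_ (sum-tabulate-affine {n} (1 + (n + n) + toℕ j) n toℕ) (sum-tabulate-const n 0)) ⟩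
    2 + 2 * toℕ (opposite j) + (n * (1 + (n + n) + toℕ j) + n * triangle n + n * 0)
      ≡⟨ lemma n (2 + 2 * toℕ (opposite j)) (n * (1 + (n + n) + toℕ j) + n * triangle n) ⟩
    rightWeight j ∎
    where
    open ≡-Reasoning
    term₁ term₂ : Fin n → ℕ
    term₁ i = neighborTerm {G} labeling (right j) (left i) (adj? (right j) (left i))
    term₂ k = neighborTerm {G} labeling (right j) (right k) (adj? (right j) (right k))
    term₂≡ : ∀ k → term₂ k ≡ 0
    term₂≡ k = neighborTerm-nonadjacent {G} labeling (right j) (right k) _ (right≁right j k)
    reassociate : ∀ c x y → c + (x + y) ≡ c + y + x
    reassociate = solve-∀
    term₁≡ : ∀ i → term₁ i ≡ 1 + (n + n) + toℕ j + n * toℕ i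
    term₁≡ i = trans
      (neighborTerm-adjacent {G} labeling (right j) (left i) _ (edgeBetween-right-left i j) (right~left j i))
      (trans (elabel-cross i j) (reassociate (1 + (n + n)) (n * toℕ i) (toℕ j)))
    lemma : ∀ n c x → c + (x + n * 0) ≡ c + x
    lemma = solve-∀

  leftWeight-mono : ∀ {i k} → toℕ i < toℕ k → leftWeight i < leftWeight k
  leftWeight-mono i<k = +-mono-<-≤ (+-monoʳ-< 1 (*-monoʳ-< 2 i<k))
    (+-monoˡ-≤ (triangle n) (*-monoʳ-≤ n (+-monoʳ-≤ (1 + (n + n)) (*-monoʳ-≤ n (<⇒≤ i<k)))))

  -- Adding `2 * toℕ j` completes the vertex label to `2 * n` and so removes `opposite`, leaving an
  -- expression affine in `j`.
  rightWeight-opposite : ∀ j → rightWeight j + 2 * toℕ j ≡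
                         n * (3 + (n + n) + toℕ j) + n * triangle n
  rightWeight-opposite j =
    trans (lemma₁ n (toℕ j) (toℕ (opposite j)) (n * triangle n))
    (trans (cong (λ m → 2 * m + (n * (1 + (n + n) + toℕ j) + n * triangle n)) (toℕ-opposite j))
           (lemma₂ n (toℕ j) (n * triangle n)))
    where
    lemma₁ : ∀ n j j′ t → 2 + 2 * j′ + (n * (1 + (n + n) + j) + t) + 2 * j ≡
                          2 * suc (j + j′) + (n * (1 + (n + n) + j) + t)
    lemma₁ = solve-∀
    lemma₂ : ∀ n j t → 2 * n + (n * (1 + (n + n) + j) + t) ≡ n * (3 + (n + n) + j) + t
    lemma₂ = solve-∀

  -- Each step to the right raises the column sum by `n` and lowers the vertex label by 2, so
  -- `2 < n` gives growth. Adding `2 * toℕ l` to both sides avoids subtraction.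
  rightWeight-mono : 2 < n → ∀ {j l} → toℕ j < toℕ l → rightWeight j < rightWeight l
  rightWeight-mono 2<n {j} {l} j<l with d , j+d≡l ← m≤n⇒∃[o]m+o≡n j<l =
    +-cancelʳ-< (2 * toℕ l) _ _ (begin-strict
      rightWeight j + 2 * toℕ l                           ≡⟨ cong (λ m → rightWeight j + 2 * m) j+d≡l ⟨
      rightWeight j + 2 * (suc (toℕ j) + d)               ≡⟨ lemma₁ (rightWeight j) (toℕ j) d ⟩
      rightWeight j + 2 * toℕ j + 2 * suc d               ≡⟨ cong (_+ 2 * suc d) (rightWeight-opposite j) ⟩
      n * (3 + (n + n) + toℕ j) + n * triangle n + 2 * suc d
        <⟨ +-monoʳ-< (n * (3 + (n + n) + toℕ j) + n * triangle n) (*-monoˡ-< (suc d) 2<n) ⟩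
      n * (3 + (n + n) + toℕ j) + n * triangle n + n * suc d  ≡⟨ lemma₂ n (toℕ j) (n * triangle n) d ⟩
      n * (3 + (n + n) + (suc (toℕ j) + d)) + n * triangle n  ≡⟨ cong (λ m → n * (3 + (n + n) + m) + n * triangle n) j+d≡l ⟩
      n * (3 + (n + n) + toℕ l) + n * triangle n          ≡⟨ rightWeight-opposite l ⟨
      rightWeight l + 2 * toℕ l                           ∎)
    where
    open ≤-Reasoning
    lemma₁ : ∀ w j d → w + 2 * (suc j + d) ≡ w + 2 * j + 2 * suc d
    lemma₁ = solve-∀
    lemma₂ : ∀ n j t d → n * (3 + (n + n) + j) + t + n * suc d ≡ n * (3 + (n + n) + (suc j + d)) + t
    lemma₂ = solve-∀

  -- Doubling the weights and adding `n + (n * n + n)` produces `2 * T + n` on the left and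
  -- `n * (2 * T + n)` on the right, which `triangle-doubled` evaluates. Cancelling the common part
  -- `C` leaves the inequality of `row≢column`.
  leftWeight≢rightWeight : 3 < n → ∀ i j → leftWeight i ≢ rightWeight j
  leftWeight≢rightWeight 3<n i j eq =
    row≢column n (toℕ i) (toℕ j) (toℕ (opposite j)) (toℕ-opposite j) 3<n
      (+-cancelˡ-≡ C _ _ (begin
        C + (4 * a + n * n * (2 * a + 2))     ≡⟨ lemma₁ n a (n * n) ⟩
        2 + 2 * (2 * a + n * (1 + (n + n) + n * a)) + n * n + (n * n + n)
          ≡⟨ cong (λ s → 2 + 2 * (2 * a + n * (1 + (n + n) + n * a)) + s + (n * n + n)) (triangle-doubled n) ⟨
        2 + 2 * (2 * a + n * (1 + (n + n) + n * a)) + (2 * T + n) + (n * n + n)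
          ≡⟨ lemma₂ a (n * (1 + (n + n) + n * a)) T n (n * n) ⟩
        2 * leftWeight i + (n + (n * n + n))    ≡⟨ cong (λ w → 2 * w + (n + (n * n + n))) eq ⟩
        2 * rightWeight j + (n + (n * n + n))   ≡⟨ lemma₃ n b b′ T ⟩
        2 * (2 + 2 * b′ + n * (1 + (n + n) + b)) + n * (2 * T + n) + (n + n)
          ≡⟨ cong (λ s → 2 * (2 + 2 * b′ + n * (1 + (n + n) + b)) + n * s + (n + n)) (triangle-doubled n) ⟩
        2 * (2 + 2 * b′ + n * (1 + (n + n) + b)) + n * (n * n) + (n + n)
          ≡⟨ lemma₄ n b b′ ⟩
        C + (2 + 4 * b′ + 2 * n * b + n * n * n + n) ∎))
    where
    open ≡-Reasoning
    a b b′ T C : ℕ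
    a = toℕ i
    b = toℕ j
    b′ = toℕ (opposite j)
    T = triangle n
    C = 2 + 3 * n + 4 * (n * n)
    lemma₁ : ∀ n a s → 2 + 3 * n + 4 * (n * n) + (4 * a + n * n * (2 * a + 2)) ≡
             2 + 2 * (2 * a + n * (1 + (n + n) + n * a)) + n * n + (n * n + n)
    lemma₁ = solve-∀
    lemma₂ : ∀ a x t n s → 2 + 2 * (2 * a + x) + (2 * t + n) + (s + n) ≡
             2 * (1 + 2 * a + (x + t)) + (n + (s + n))
    lemma₂ = solve-∀
    lemma₃ : ∀ n b b′ t → 2 * (2 + 2 * b′ + (n * (1 + (n + n) + b) + n * t)) + (n + (n * n + n)) ≡
             2 * (2 + 2 * b′ + n * (1 + (n + n) + b)) + n * (2 * t + n) + (n + n)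
    lemma₃ = solve-∀
    lemma₄ : ∀ n b b′ → 2 * (2 + 2 * b′ + n * (1 + (n + n) + b)) + n * (n * n) + (n + n) ≡
             2 + 3 * n + 4 * (n * n) + (2 + 4 * b′ + 2 * n * b + n * n * n + n)
    lemma₄ = solve-∀

  vertexAntimagic : 3 < n → VertexAntimagic {G} labeling
  vertexAntimagic 3<n {u} {v} = go (side u) (side v)
    where
    go : ∀ {u v} → Side u → Side v → vertexWeight {G} labeling u ≡ vertexWeight {G} labeling v → u ≡ v
    go (isLeft i) (isLeft k) eq = cong left
      (strictlyMonotone⇒injective leftWeight leftWeight-mono i k
        (trans (sym (vertexWeight-left i)) (trans eq (vertexWeight-left k))))
    go (isLeft i) (isRight j) eq = contradiction
      (trans (sym (vertexWeight-left i)) (trans eq (vertexWeight-right j))) (leftWeight≢rightWeight 3<n i j)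
    go (isRight j) (isLeft i) eq = contradiction
      (trans (sym (vertexWeight-left i)) (trans (sym eq) (vertexWeight-right j))) (leftWeight≢rightWeight 3<n i j)
    go (isRight j) (isRight l) eq = cong right
      -- `<⇒≤ 3<n` is `3 ≤ n`, which is `2 < n` by definition.
      (strictlyMonotone⇒injective rightWeight (rightWeight-mono (<⇒≤ 3<n)) j l
        (trans (sym (vertexWeight-right j)) (trans eq (vertexWeight-right l))))

theorem2p1 : (n : ℕ) → n > 3 → IsWeakOrderedSuperTAT (completeBipartite n n)
theorem2p1 n n>3 =
  labeling n , weakOrdered-singletons (labeling n) (<-≤-trans (s≤s z≤n) (≤-trans n>3 (m≤m+n n n))) ,
  super n , edgeAntimagic n , vertexAntimagic n n>3
  where open CompleteBipartite
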